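{- $\mathrm{ex}_<(n,P_5^{1342})=O(n\log^2 n)$.
   Context: Edge-ordered graph: finite simple graph with a linear order on its edges; isomorphisms preserve order; subgraphs carry induced order; $\mathrm{ex}_<(n,H)$ is the maximum number of edges of an edge-ordered graph on $n$ vertices with no subgraph isomorphic to $H$. Notation: $P_k^{a_1\dots a_{k-1}}$ is the path $v_1\dots v_k$ where edge $v_iv_{i+1}$ has label $a_i$ and edges are ordered by label. -}

module Defs where

open import Data.Nat using (ℕ; _<_; _<ᵇ_)
open import Data.Fin using (Fin; toℕ)
open import Data.Bool using (Bool; true; false; if_then_else_; _∧_)
open import Data.List using (map; allFin)
open import Data.Nat.ListAction using (sum)
open import Data.Product using (_×_; ∃-syntax)
open import Data.Sum using (_⊎_)
open import Relation.Binary.PropositionalEquality using (_≡_; _≢_)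

-- An edge-ordered (finite simple) graph on vertex set Fin n.
-- The linear order on edges is given by injective labels in ℕ
-- (every linear order on a finite set arises this way); e < f iff label e < label f.
record EOGraph (n : ℕ) : Set where
  field
    adj       : Fin n → Fin n → Bool
    adj-sym   : ∀ i j → adj i j ≡ adj j i
    adj-irr   : ∀ i → adj i i ≡ false
    label     : Fin n → Fin n → ℕ
    label-sym : ∀ i j → label i j ≡ label j i
    label-inj : ∀ i j k l → adj i j ≡ true → adj k l ≡ true →
                label i j ≡ label k l → (i ≡ k × j ≡ l) ⊎ (i ≡ l × j ≡ k)

open EOGraph public

edgeCount : ∀ {n} → EOGraph n → ℕ
edgeCount {n} G =
  sum (map (λ i → sum (map (λ j → if adj G i j ∧ (toℕ i <ᵇ toℕ j) then 1 else 0)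
                           (allFin n)))
           (allFin n))

-- G contains P_5^{1342}: distinct vertices v1..v5 with edges
-- e1 = v1v2, e2 = v2v3, e3 = v3v4, e4 = v4v5 ordered e1 < e4 < e2 < e3
-- (labels 1,3,4,2 on e1,e2,e3,e4).
ContainsP5-1342 : ∀ {n} → EOGraph n → Set
ContainsP5-1342 {n} G =
  ∃[ v1 ] ∃[ v2 ] ∃[ v3 ] ∃[ v4 ] ∃[ v5 ]
    ( (v1 ≢ v2 × v1 ≢ v3 × v1 ≢ v4 × v1 ≢ v5 × v2 ≢ v3 × v2 ≢ v4 × v2 ≢ v5
       × v3 ≢ v4 × v3 ≢ v5 × v4 ≢ v5)
    × (adj G v1 v2 ≡ true × adj G v2 v3 ≡ true × adj G v3 v4 ≡ true × adj G v4 v5 ≡ true)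
    × (label G v1 v2 < label G v4 v5 × label G v4 v5 < label G v2 v3
       × label G v2 v3 < label G v3 v4) )

{-# OPTIONS --safe #-}
module Submission where

-- Replace labels by ranks, so that they are at most n². For a vertex a let base a
-- be the rank of its third smallest edge. Discard the edges of rank at most the
-- base of one of their ends, and split the remaining ordered edges (a , b) into
-- O(log² n) classes according to the dyadic scales s of rank − base a and r of
-- rank − base b. In a class, call an edge early if it is among the two smallest
-- edges of the class at one of its ends; there are O(n) early edges per class.
--
-- Every edge ab of a class is early. Otherwise take smaller edges a b₁ and a₁ b of
-- the same class with a₁ ≢ b₁, and suppose a b₁ is below a₁ b (the other case
-- is symmetric). Since ab and a b₁ have the same scale 2^s at a, they are less
-- than 2^s apart, and so are a b₁ and a₁ b; but a₁ b is at least 2^s above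
-- base a₁. Hence base a₁ lies below a b₁, and one of the three smallest edges
-- v₁a₁ at a₁ completes the path v₁ a₁ b a b₁, whose labels are ordered 1342.

open import Defs
open import Data.Bool using (true; false; if_then_else_; _∧_)
open import Data.Bool.Properties using () renaming (_≟_ to _≟ᵇ_)
open import Data.Empty using (⊥; ⊥-elim)
open import Data.Fin using (Fin; zero; suc; toℕ; fromℕ<)
open import Data.Fin.Properties using (toℕ-fromℕ<) renaming (_≟_ to _≟ᶠ_; suc-injective to suc-injectiveᶠ)
open import Data.List using (map; allFin; tabulate)
open import Data.List.Properties using (map-tabulate)
open import Data.Nat using (ℕ; zero; suc; _+_; _≤_; _<_; _*_; _^_; z≤n; s≤s; _≤?_; _<?_; _<ᵇ_)
open import Data.Nat.Logarithm using (⌊log₂_⌋; ⌊log₂⌋-mono-≤; ⌊log₂[2^n]⌋≡n)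
open import Data.Nat.Properties
open import Data.Nat.Solver using (module +-*-Solver)
open import Data.Product using (∃-syntax; _×_; _,_)
open import Data.Sum using (_⊎_; inj₁; inj₂)
open import Function using (_∘_; id)
open import Relation.Binary.Definitions using (tri<; tri≈; tri>)
open import Relation.Binary.PropositionalEquality using (_≡_; _≢_; refl; sym; trans; cong; cong₂; subst)
open import Relation.Nullary using (¬_; Dec; yes; no; does; contradiction; ¬?; _×-dec_)
open import Relation.Nullary.Decidable using (map′)
open import Relation.Unary using (Pred; Decidable)
open import Level using (0ℓ)
import Algebra.Properties.CommutativeMonoid.Sum
import Data.Nat.ListAction as List

open Algebra.Properties.CommutativeMonoid.Sum +-0-commutativeMonoid using (sum; sum-cong-≗; ∑-distrib-+; ∑-comm)

-- Finite sums over `Fin n`.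

sum-allFin : ∀ {n} (f : Fin n → ℕ) → List.sum (map f (allFin n)) ≡ sum f
sum-allFin f = trans (cong List.sum (map-tabulate id f)) (sum-tabulate f)
  where
  sum-tabulate : ∀ {n} (f : Fin n → ℕ) → List.sum (tabulate f) ≡ sum f
  sum-tabulate {zero}  f = refl
  sum-tabulate {suc n} f = cong (f zero +_) (sum-tabulate (f ∘ suc))

sum-mono-≤ : ∀ {n} {f g : Fin n → ℕ} → (∀ i → f i ≤ g i) → sum f ≤ sum g
sum-mono-≤ {zero}  f≤g = z≤n
sum-mono-≤ {suc n} f≤g = +-mono-≤ (f≤g zero) (sum-mono-≤ (f≤g ∘ suc))

sum-mono-< : ∀ {n} {f g : Fin n → ℕ} → (∀ i → f i ≤ g i) → ∀ i → f i < g i → sum f < sum g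
sum-mono-< f≤g zero    f<g = +-mono-<-≤ f<g (sum-mono-≤ (f≤g ∘ suc))
sum-mono-< f≤g (suc i) f<g = +-mono-≤-< (f≤g zero) (sum-mono-< (f≤g ∘ suc) i f<g)

sum-≤-* : ∀ {n} {f : Fin n → ℕ} {c} → (∀ i → f i ≤ c) → sum f ≤ n * c
sum-≤-* {zero}  f≤c = z≤n
sum-≤-* {suc n} f≤c = +-mono-≤ (f≤c zero) (sum-≤-* (f≤c ∘ suc))

term≤sum : ∀ {n} (f : Fin n → ℕ) i → f i ≤ sum f
term≤sum f zero    = m≤m+n _ _
term≤sum f (suc i) = ≤-trans (term≤sum (f ∘ suc) i) (m≤n+m _ _)

-- Indicators and counting of decidable predicates.

⟦_⟧ : ∀ {A : Set} → Dec A → ℕ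
⟦ A? ⟧ = if does A? then 1 else 0

⟦⟧≤1 : ∀ {A : Set} (A? : Dec A) → ⟦ A? ⟧ ≤ 1
⟦⟧≤1 (yes _) = ≤-refl
⟦⟧≤1 (no _)  = z≤n

⟦⟧-≤ : ∀ {A : Set} (A? : Dec A) {m} → (A → 1 ≤ m) → ⟦ A? ⟧ ≤ m
⟦⟧-≤ (yes a) h = h a
⟦⟧-≤ (no _)  h = z≤n

if-∧-≤ : ∀ x y {m} → (x ≡ true → 1 ≤ m) → (if x ∧ y then 1 else 0) ≤ m
if-∧-≤ true  true  h = h refl
if-∧-≤ true  false h = z≤n
if-∧-≤ false _     h = z≤n

⟦⟧-yes : ∀ {A : Set} (A? : Dec A) → A → 1 ≤ ⟦ A? ⟧
⟦⟧-yes (yes _) a = ≤-refl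
⟦⟧-yes (no ¬a) a = contradiction a ¬a

⟦⟧-no : ∀ {A : Set} (A? : Dec A) → ¬ A → ⟦ A? ⟧ < 1
⟦⟧-no (yes a) ¬a = contradiction a ¬a
⟦⟧-no (no _)  ¬a = ≤-refl

count : ∀ {n} {P : Pred (Fin n) 0ℓ} → Decidable P → ℕ
count P? = sum (λ i → ⟦ P? i ⟧)

count-mono : ∀ {n} {P Q : Pred (Fin n) 0ℓ} (P? : Decidable P) (Q? : Decidable Q) →
             (∀ i → P i → Q i) → count P? ≤ count Q?
count-mono P? Q? P⊆Q = sum-mono-≤ λ i → ⟦⟧-≤ (P? i) λ p → ⟦⟧-yes (Q? i) (P⊆Q i p)

count-⊎ : ∀ {n} {P Q R : Pred (Fin n) 0ℓ} (P? : Decidable P) (Q? : Decidable Q) (R? : Decidable R) →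
          (∀ i → P i → Q i ⊎ R i) → count P? ≤ count Q? + count R?
count-⊎ P? Q? R? P⊆Q∪R = ≤-trans (sum-mono-≤ pointwise) (≤-reflexive (∑-distrib-+ (λ i → ⟦ Q? i ⟧) (λ i → ⟦ R? i ⟧)))
  where
  pointwise : ∀ i → ⟦ P? i ⟧ ≤ ⟦ Q? i ⟧ + ⟦ R? i ⟧
  pointwise i = ⟦⟧-≤ (P? i) λ p → case (P⊆Q∪R i p)
    where
    case : _ ⊎ _ → 1 ≤ ⟦ Q? i ⟧ + ⟦ R? i ⟧
    case (inj₁ q) = ≤-trans (⟦⟧-yes (Q? i) q) (m≤m+n _ _)
    case (inj₂ r) = ≤-trans (⟦⟧-yes (R? i) r) (m≤n+m _ _)

count-empty : ∀ {n} {P : Pred (Fin n) 0ℓ} (P? : Decidable P) → (∀ i → ¬ P i) → count P? ≤ 0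
count-empty {n} P? ¬P = ≤-trans (sum-≤-* λ i → ⟦⟧-≤ (P? i) λ p → contradiction p (¬P i)) (≤-reflexive (*-zeroʳ n))

count-unique : ∀ {n} {P : Pred (Fin n) 0ℓ} (P? : Decidable P) →
               (∀ {i j} → P i → P j → i ≡ j) → count P? ≤ 1
count-unique {zero}  P? unique = z≤n
count-unique {suc n} P? unique with P? zero
... | yes p = s≤s (count-empty (P? ∘ suc) λ i q → contradiction (unique p q) λ ())
... | no _  = count-unique (P? ∘ suc) λ p q → suc-injectiveᶠ (unique p q)

count-witness : ∀ {n} {P : Pred (Fin n) 0ℓ} (P? : Decidable P) → 0 < count P? → ∃[ i ] P i
count-witness {suc n} P? 0<c with P? zero
... | yes p = zero , p
... | no _  = let i , p = count-witness (P? ∘ suc) 0<c in suc i , p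

_∖_ : ∀ {n} {P : Pred (Fin n) 0ℓ} → Decidable P → (x : Fin n) → Decidable (λ i → P i × i ≢ x)
(P? ∖ x) i = P? i ×-dec ¬? (i ≟ᶠ x)

-- Used to pick witnesses that avoid prescribed vertices: each excluded vertex costs at most one
-- element.
count-∖ : ∀ {n} {P : Pred (Fin n) 0ℓ} (P? : Decidable P) x {k} → suc k ≤ count P? → k ≤ count (P? ∖ x)
count-∖ {P = P} P? x {k} k<c = +-cancelʳ-≤ 1 k _ (begin
  k + 1                                   ≡⟨ +-comm k 1 ⟩
  suc k                                   ≤⟨ k<c ⟩
  count P?                                ≤⟨ count-⊎ P? (P? ∖ x) (_≟ᶠ x) split ⟩
  count (P? ∖ x) + count (_≟ᶠ x)          ≤⟨ +-monoʳ-≤ (count (P? ∖ x)) (count-unique (_≟ᶠ x) λ p q → trans p (sym q)) ⟩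
  count (P? ∖ x) + 1                      ∎)
  where
  open ≤-Reasoning
  split : ∀ i → P i → (P i × i ≢ x) ⊎ i ≡ x
  split i p with i ≟ᶠ x
  ... | yes i≡x = inj₂ i≡x
  ... | no  i≢x = inj₁ (p , i≢x)

-- Thresholds for the smallest values of an injective function.

module _ {n} {P : Pred (Fin n) 0ℓ} (P? : Decidable P) (R : Fin n → ℕ)
         (R-injective : ∀ {i j} → P i → P j → R i ≡ R j → i ≡ j) where

  below? : ∀ t → Decidable (λ i → P i × R i ≤ t)
  below? t i = P? i ×-dec (R i ≤? t)

  -- The level is the k-th smallest value of R on P; if P has fewer than k elements,
  -- it is a bound for all values and saturated holds vacuously.
  record Threshold (k : ℕ) : Set where
    field
      level     : ℕ
      atMost    : count (below? level) ≤ k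
      saturated : ∀ i → P i → level < R i → k ≤ count (below? level)

  abstract
    -- Raise `t` from 0. By injectivity the count grows by at most one per step, so it cannot jump
    -- over `suc k`; the search stops there or at the bound `T`.
    threshold : ∀ k T → (∀ i → R i ≤ T) → Threshold (suc k)
    threshold k T R≤T with search T
      where
      count-step : ∀ t → count (below? (suc t)) ≤ count (below? t) + 1
      count-step t = ≤-trans
        (count-⊎ (below? (suc t)) (below? t) at? split)
        (+-monoʳ-≤ (count (below? t)) (count-unique at? λ (p , e) (q , f) → R-injective p q (trans e (sym f))))
        where
        at? : Decidable (λ i → P i × R i ≡ suc t)
        at? i = P? i ×-dec (R i ≟ suc t)

        split : ∀ i → P i × R i ≤ suc t → (P i × R i ≤ t) ⊎ (P i × R i ≡ suc t)
        split i (p , le) with R i ≤? t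
        ... | yes le′ = inj₁ (p , le′)
        ... | no  gt  = inj₂ (p , ≤-antisym le (≰⇒> gt))

      search : ∀ T → ∃[ t ] (count (below? t) ≤ suc k × (suc k ≤ count (below? t) ⊎ T ≤ t))
      -- The count at level 0 may already be 1, hence the bound `suc k` instead of `k`.
      search zero = 0 , ≤-trans (count-unique (below? 0) unique) (s≤s z≤n) , inj₂ z≤n
        where
        unique : ∀ {i j} → P i × R i ≤ 0 → P j × R j ≤ 0 → i ≡ j
        unique (p , e) (q , f) = R-injective p q (trans (n≤0⇒n≡0 e) (sym (n≤0⇒n≡0 f)))
      search (suc T) with search T
      ... | t , le , inj₁ ge = t , le , inj₁ ge
      ... | t , le , inj₂ T≤t with suc k ≤? count (below? t)
      ...   | yes ge = t , le , inj₁ ge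
      ...   | no  lt = suc t , ≤-trans (count-step t) (≤-trans (≤-reflexive (+-comm _ 1)) (≰⇒> lt)) , inj₂ (s≤s T≤t)
    ... | t , le , inj₁ ge  = record { level = t ; atMost = le ; saturated = λ _ _ _ → ge }
    ... | t , le , inj₂ T≤t = record
      { level = t ; atMost = le
      ; saturated = λ i _ t<R → contradiction (≤-trans (R≤T i) T≤t) (<⇒≱ t<R) }

-- Dyadic scales and logarithms.

dyadic-scale : ∀ d → ∃[ s ] (2 ^ s ≤ suc d × suc d < 2 ^ suc s)
dyadic-scale zero = 0 , ≤-refl , ≤-refl
dyadic-scale (suc d) with dyadic-scale d
... | s , lo , hi with suc (suc d) <? 2 ^ suc s
...   | yes lt = s , m≤n⇒m≤1+n lo , lt
-- `suc d` was below `2 ^ suc s`, so `suc (suc d)` equals that power and opens the next scale.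
...   | no  ge = suc s , ≤-reflexive eq , subst (_< 2 ^ suc (suc s)) eq (^-monoʳ-< 2 (s≤s (s≤s z≤n)) (n<1+n (suc s)))
  where
  eq : 2 ^ suc s ≡ suc (suc d)
  eq = ≤-antisym (≮⇒≥ ge) hi

n<2^[1+⌊log₂n⌋] : ∀ n → n < 2 ^ suc ⌊log₂ n ⌋
n<2^[1+⌊log₂n⌋] n = ≰⇒> λ le → 1+n≰n (subst (_≤ ⌊log₂ n ⌋) (⌊log₂[2^n]⌋≡n (suc ⌊log₂ n ⌋)) (⌊log₂⌋-mono-≤ le))

-- Adjacency and edge ranks.

module Proof {n : ℕ} (G : EOGraph n) where

  Adj : Fin n → Fin n → Set
  Adj a b = adj G a b ≡ true

  adj? : ∀ a → Decidable (Adj a)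
  adj? a b = adj G a b ≟ᵇ true

  Adj-sym : ∀ {a b} → Adj a b → Adj b a
  Adj-sym {a} {b} ab = trans (adj-sym G b a) ab

  Adj-irrefl : ∀ {a b} → Adj a b → a ≢ b
  Adj-irrefl {a} aa refl with () ← trans (sym aa) (adj-irr G a)

  smaller? : ∀ a b k → Decidable (λ l → Adj k l × label G k l < label G a b)
  smaller? a b k l = adj? k l ×-dec (label G k l <? label G a b)

  abstract
    -- Ordered pairs are counted, so each smaller edge contributes twice; all that matters is the
    -- order and the bound `n * n`, which limits the number of scales.
    rank : Fin n → Fin n → ℕ
    rank a b = sum λ k → count (smaller? a b k)

    rank-sym : ∀ a b → rank a b ≡ rank b a
    rank-sym a b = cong (λ x → sum λ k → count λ l → adj? k l ×-dec (label G k l <? x)) (label-sym G a b)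

    rank-≤ : ∀ a b → rank a b ≤ n * n
    rank-≤ a b = sum-≤-* λ k → ≤-trans (sum-≤-* λ l → ⟦⟧≤1 (smaller? a b k l)) (≤-reflexive (*-identityʳ n))

    smaller-mono : ∀ {a b c d} → label G a b ≤ label G c d → ∀ k → count (smaller? a b k) ≤ count (smaller? c d k)
    smaller-mono {a} {b} {c} {d} le k = count-mono (smaller? a b k) (smaller? c d k) λ l (kl , lt) → kl , <-≤-trans lt le

    rank-mono-≤ : ∀ {a b c d} → label G a b ≤ label G c d → rank a b ≤ rank c d
    rank-mono-≤ le = sum-mono-≤ (smaller-mono le)

    -- The pair (`a` , `b`) itself makes the inequality strict: it is counted on the right but not
    -- on the left.
    rank-mono-< : ∀ {a b c d} → Adj a b → label G a b < label G c d → rank a b < rank c d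
    rank-mono-< {a} {b} {c} {d} ab lt = sum-mono-< (smaller-mono (<⇒≤ lt)) a
      (sum-mono-< (λ l → ⟦⟧-≤ (smaller? a b a l) λ (al , lt′) → ⟦⟧-yes (smaller? c d a l) (al , <-trans lt′ lt)) b
        (<-≤-trans (⟦⟧-no (smaller? a b a b) λ (_ , lt′) → <-irrefl refl lt′) (⟦⟧-yes (smaller? c d a b) (ab , lt))))

  rank-cancel-< : ∀ {a b c d} → rank a b < rank c d → label G a b < label G c d
  rank-cancel-< lt = ≰⇒> λ le → <⇒≱ lt (rank-mono-≤ le)

  rank-injective : ∀ {a b c d} → Adj a b → Adj c d → rank a b ≡ rank c d → (a ≡ c × b ≡ d) ⊎ (a ≡ d × b ≡ c)
  rank-injective {a} {b} {c} {d} ab cd eq with <-cmp (label G a b) (label G c d)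
  ... | tri< lt _ _ = contradiction eq (<⇒≢ (rank-mono-< ab lt))
  ... | tri≈ _ e _  = label-inj G a b c d ab cd e
  ... | tri> _ _ gt = contradiction (sym eq) (<⇒≢ (rank-mono-< cd gt))

  rank-injectiveʳ : ∀ {a b c} → Adj a b → Adj a c → rank a b ≡ rank a c → b ≡ c
  rank-injectiveʳ ab ac eq with rank-injective ab ac eq
  ... | inj₁ (_ , b≡c)   = b≡c
  ... | inj₂ (a≡c , b≡a) = trans b≡a a≡c

  -- Bases, scales and classes.

  baseThreshold : ∀ a → Threshold (adj? a) (rank a) rank-injectiveʳ 3
  -- Three low edges: two of their ends may have to be avoided, and one must remain.
  baseThreshold a = threshold (adj? a) (rank a) rank-injectiveʳ 2 (n * n) (rank-≤ a)

  module Base a = Threshold (baseThreshold a)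

  base : Fin n → ℕ
  base = Base.level

  low? : ∀ a → Decidable (λ b → Adj a b × rank a b ≤ base a)
  low? a = below? (adj? a) (rank a) rank-injectiveʳ (base a)

  record Scale (s : ℕ) (a b : Fin n) : Set where
    constructor _,ˢ_
    field
      lower : base a + 2 ^ s ≤ rank a b
      upper : rank a b < base a + 2 ^ suc s

  open Scale

  -- Both scales are fixed so that an edge from `b` to some `a₁` in the same class has the scale at
  -- `a₁` that the edge from `a` to `b` has at `a`.
  record Class (s r : ℕ) (a b : Fin n) : Set where
    constructor class
    field
      edge   : Adj a b
      scaleˡ : Scale s a b
      scaleʳ : Scale r b a

  open Class

  scale? : ∀ s a b → Dec (Scale s a b)
  scale? s a b = map′ (λ (lo , hi) → lo ,ˢ hi) (λ sc → lower sc , upper sc)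
    ((base a + 2 ^ s ≤? rank a b) ×-dec (rank a b <? base a + 2 ^ suc s))

  class? : ∀ s r a → Decidable (Class s r a)
  class? s r a b = map′ (λ (e , l , r) → class e l r) (λ c → edge c , scaleˡ c , scaleʳ c)
    (adj? a b ×-dec (scale? s a b ×-dec scale? r b a))

  class-sym : ∀ {s r a b} → Class s r a b → Class r s b a
  class-sym (class ab sa sb) = class (Adj-sym ab) sb sa

  class-injective : ∀ {s r a b c} → Class s r a b → Class s r a c → rank a b ≡ rank a c → b ≡ c
  class-injective c d = rank-injectiveʳ (edge c) (edge d)

  -- Two early edges, so that one is left when a single end has to be avoided.
  earlyThreshold : ∀ s r a → Threshold (class? s r a) (rank a) class-injective 2
  earlyThreshold s r a = threshold (class? s r a) (rank a) class-injective 1 (n * n) (rank-≤ a)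

  module Early s r a = Threshold (earlyThreshold s r a)

  early? : ∀ s r a → Decidable (λ b → Class s r a b × rank a b ≤ Early.level s r a)
  early? s r a = below? (class? s r a) (rank a) class-injective (Early.level s r a)

  scale-exists : ∀ {a b} → base a < rank a b → ∃[ s ] Scale s a b
  scale-exists {a} {b} lt with m≤n⇒∃[o]m+o≡n lt
  ... | d , eq with dyadic-scale d
  ...   | s , lo , hi = s , (subst (base a + 2 ^ s ≤_) eq′ (+-monoʳ-≤ (base a) lo)
                          ,ˢ subst (_< base a + 2 ^ suc s) eq′ (+-monoʳ-< (base a) hi))
    where
    eq′ : base a + suc d ≡ rank a b
    eq′ = trans (+-suc (base a) d) eq

  scale>base : ∀ {s a b} → Scale s a b → base a < rank a b
  scale>base {s} {a} sc = <-≤-trans (m<m+n (base a) (m^n>0 2 s)) (lower sc)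

  -- Chosen so that `2 ^ scales` exceeds `n * n`, the bound on ranks.
  scales : ℕ
  scales = 2 * suc ⌊log₂ n ⌋

  scale-< : ∀ {s a b} → Scale s a b → s < scales
  scale-< {s} {a} {b} sc = ≰⇒> λ le → <⇒≱ n*n<2^scales (≤-trans (^-monoʳ-≤ 2 le) (≤-trans (m+n≤o⇒n≤o (base a) (lower sc)) (rank-≤ a b)))
    where
    L = suc ⌊log₂ n ⌋
    n*n<2^scales : n * n < 2 ^ scales
    n*n<2^scales = subst (n * n <_) (trans (sym (^-distribˡ-+-* 2 L L)) (cong (λ x → 2 ^ (L + x)) (sym (+-identityʳ L))))
      (*-mono-< (n<2^[1+⌊log₂n⌋] n) (n<2^[1+⌊log₂n⌋] n))

  -- Finding the forbidden path.

  module _ (P-free : ¬ ContainsP5-1342 G) where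

    no-crossing : ∀ {s a b a₁ b₁} → Scale s a b → Scale s a b₁ → Scale s a₁ b →
                  Adj a b → Adj a b₁ → Adj a₁ b → a₁ ≢ b₁ →
                  rank a b₁ < rank a₁ b → rank a₁ b < rank a b → ⊥
    no-crossing {s} {a} {b} {a₁} {b₁} ab-scale ab₁-scale a₁b-scale ab ab₁ a₁b a₁≢b₁ ab₁<a₁b a₁b<ab
      with base a₁ <? rank a b₁
    -- If `base a₁` were at least `rank a b₁`, two increments of `2 ^ s`, one above `base a` and one
    -- above `base a₁`, would lift `rank a₁ b` to the upper end of the scale of `rank a b`.
    ... | no base≥ = <-irrefl refl (begin-strict
      base a + 2 ^ suc s             ≡⟨ cong (λ x → base a + (2 ^ s + x)) (+-identityʳ (2 ^ s)) ⟩
      base a + (2 ^ s + 2 ^ s)       ≡⟨ sym (+-assoc (base a) _ _) ⟩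
      base a + 2 ^ s + 2 ^ s         ≤⟨ +-monoˡ-≤ (2 ^ s) (lower ab₁-scale) ⟩
      rank a b₁ + 2 ^ s              ≤⟨ +-monoˡ-≤ (2 ^ s) (≮⇒≥ base≥) ⟩
      base a₁ + 2 ^ s                ≤⟨ lower a₁b-scale ⟩
      rank a₁ b                      <⟨ a₁b<ab ⟩
      rank a b                       <⟨ upper ab-scale ⟩
      base a + 2 ^ suc s             ∎)
      where open ≤-Reasoning
    -- The edge from `a₁` to `b` lies above `base a₁`, so `a₁` has three low edges; one of them ends
    -- outside `a` and `b₁`.
    ... | yes base< with count-witness ((low? a₁ ∖ a) ∖ b₁)
                           (count-∖ (low? a₁ ∖ a) b₁ (count-∖ (low? a₁) a
                             (Base.saturated a₁ b a₁b (scale>base a₁b-scale))))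
    ...   | v₁ , ((a₁v₁ , v₁-low) , v₁≢a) , v₁≢b₁ = P-free
      ( v₁ , a₁ , b , a , b₁
      , ( Adj-irrefl (Adj-sym a₁v₁)
        -- The end `v₁` differs from `b` because the edge from `a₁` to `b` is not low.
        , (λ { refl → <⇒≱ (scale>base a₁b-scale) v₁-low })
        , v₁≢a , v₁≢b₁
        , Adj-irrefl a₁b
        , (λ { refl → <-irrefl refl a₁b<ab })
        , a₁≢b₁
        , Adj-irrefl (Adj-sym ab)
        , (λ { refl → <-asym ab₁<a₁b a₁b<ab })
        , Adj-irrefl ab₁ )
      , (Adj-sym a₁v₁ , a₁b , Adj-sym ab , ab₁)
      , ( rank-cancel-< (≤-<-trans (≤-trans (≤-reflexive (rank-sym v₁ a₁)) v₁-low) base<)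
        , rank-cancel-< ab₁<a₁b
        , rank-cancel-< (<-≤-trans a₁b<ab (≤-reflexive (rank-sym a b))) ) )

    early : ∀ {s r a b} → Class s r a b → rank a b ≤ Early.level s r a ⊎ rank b a ≤ Early.level r s b
    early {s} {r} {a} {b} c@(class ab sa sb) with rank a b ≤? Early.level s r a | rank b a ≤? Early.level r s b
    ... | yes e | _     = inj₁ e
    ... | no _  | yes e = inj₂ e
    ... | no ea | no eb
      with count-witness (early? s r a) (≤-trans (n≤1+n _) (Early.saturated s r a b c (≰⇒> ea)))
    ...   | b₁ , class ab₁ ab₁-scale b₁a-scale , ab₁-early
      -- At `a` any early edge will do; at `b` the second early edge is needed to make `a₁` differ
      -- from `b₁`.
      with count-witness (early? r s b ∖ b₁) (count-∖ (early? r s b) b₁ (Early.saturated r s b a (class-sym c) (≰⇒> eb)))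
    ...     | a₁ , (class ba₁ ba₁-scale a₁b-scale , ba₁-early) , a₁≢b₁
      with <-cmp (rank a b₁) (rank b a₁)
    ...       | tri< lt _ _ = ⊥-elim
      (no-crossing sa ab₁-scale a₁b-scale ab ab₁ (Adj-sym ba₁) a₁≢b₁
        (<-≤-trans lt (≤-reflexive (rank-sym b a₁)))
        (≤-<-trans (≤-trans (≤-reflexive (rank-sym a₁ b)) ba₁-early) (<-≤-trans (≰⇒> eb) (≤-reflexive (rank-sym b a)))))
    -- The same argument with `a` and `b`, and with `s` and `r`, exchanged.
    ...       | tri> _ _ gt = ⊥-elim
      (no-crossing sb ba₁-scale b₁a-scale (Adj-sym ab) ba₁ (Adj-sym ab₁) (a₁≢b₁ ∘ sym)
        (<-≤-trans gt (≤-reflexive (rank-sym a b₁)))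
        (≤-<-trans (≤-trans (≤-reflexive (rank-sym b₁ a)) ab₁-early) (<-≤-trans (≰⇒> ea) (≤-reflexive (rank-sym a b)))))
    -- Equal ranks mean equal edges: either `a₁` is `b₁`, or `b₁` is `b` and the edge from `a` to
    -- `b` is early after all.
    ...       | tri≈ _ eq _ with rank-injective ab₁ ba₁ eq
    ...         | inj₁ (_ , b₁≡a₁) = contradiction (sym b₁≡a₁) a₁≢b₁
    ...         | inj₂ (_ , refl)  = contradiction ab₁-early ea

    -- Charging edges to their ends.

    abstract
      -- Summing over all pairs of scales avoids choosing a class for each edge.
      earlyCharge charge : Fin n → Fin n → ℕ
      earlyCharge a b = sum {scales} λ s → sum {scales} λ r → ⟦ early? (toℕ s) (toℕ r) a b ⟧
      charge a b = ⟦ low? a b ⟧ + earlyCharge a b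

      low-charged : ∀ {a b} → Adj a b → rank a b ≤ base a → 1 ≤ charge a b
      low-charged {a} {b} ab le = ≤-trans (⟦⟧-yes (low? a b) (ab , le)) (m≤m+n ⟦ low? a b ⟧ (earlyCharge a b))

      early-charged : ∀ {s r a b} → Class s r a b → rank a b ≤ Early.level s r a → 1 ≤ charge a b
      early-charged {s} {r} {a} {b} c@(class ab sa sb) le = begin
        1
          ≤⟨ ⟦⟧-yes (early? s r a b) (c , le) ⟩
        ⟦ early? s r a b ⟧
          ≡⟨ cong₂ (λ x y → ⟦ early? x y a b ⟧) (toℕ-fromℕ< (scale-< sa)) (toℕ-fromℕ< (scale-< sb)) ⟨
        ⟦ early? (toℕ s′) (toℕ r′) a b ⟧
          ≤⟨ term≤sum {scales} (λ r → ⟦ early? (toℕ s′) (toℕ r) a b ⟧) r′ ⟩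
        (sum {scales} λ r → ⟦ early? (toℕ s′) (toℕ r) a b ⟧)
          ≤⟨ term≤sum {scales} (λ s → sum {scales} λ r → ⟦ early? (toℕ s) (toℕ r) a b ⟧) s′ ⟩
        earlyCharge a b
          ≤⟨ m≤n+m (earlyCharge a b) ⟦ low? a b ⟧ ⟩
        charge a b ∎
        where
        open ≤-Reasoning
        s′ r′ : Fin scales
        s′ = fromℕ< (scale-< sa)
        r′ = fromℕ< (scale-< sb)

      -- Exchanging the sums gives one count per pair of scales: at most 3 low edges, and at most 2
      -- early ones for each pair.
      row-charge : ∀ a → sum (charge a) ≤ 3 + scales * (scales * 2)
      row-charge a = begin
        sum (charge a)
          ≡⟨ ∑-distrib-+ (λ b → ⟦ low? a b ⟧) (earlyCharge a) ⟩
        count (low? a) + sum (earlyCharge a)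
          ≡⟨ cong (count (low? a) +_) (∑-comm λ b s → sum {scales} λ r → E s r b) ⟩
        count (low? a) + (sum {scales} λ s → sum {n} λ b → sum {scales} λ r → E s r b)
          ≡⟨ cong (count (low? a) +_) (sum-cong-≗ {scales} λ s → ∑-comm λ b r → E s r b) ⟩
        count (low? a) + (sum {scales} λ s → sum {scales} λ r → count (early? (toℕ s) (toℕ r) a))
          ≤⟨ +-mono-≤ (Base.atMost a) (sum-≤-* {scales} λ s → sum-≤-* {scales} λ r → Early.atMost (toℕ s) (toℕ r) a) ⟩
        3 + scales * (scales * 2) ∎
        where
        open ≤-Reasoning
        E : Fin scales → Fin scales → Fin n → ℕ
        E s r b = ⟦ early? (toℕ s) (toℕ r) a b ⟧

    -- An edge that is low at neither end has a scale at both, so it lies in a class and `early`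
    -- applies.
    edge-charged : ∀ {a b} → Adj a b → 1 ≤ charge a b + charge b a
    edge-charged {a} {b} ab with rank a b ≤? base a | rank b a ≤? base b
    ... | yes le | _      = m≤n⇒m≤n+o (charge b a) (low-charged ab le)
    ... | no _   | yes le = m≤n⇒m≤o+n (charge a b) (low-charged (Adj-sym ab) le)
    ... | no gta | no gtb with scale-exists (≰⇒> gta) | scale-exists (≰⇒> gtb)
    ...   | s , sa | r , sb with early (class ab sa sb)
    ...     | inj₁ le = m≤n⇒m≤n+o (charge b a) (early-charged (class ab sa sb) le)
    ...     | inj₂ le = m≤n⇒m≤o+n (charge a b) (early-charged (class (Adj-sym ab) sb sa) le)

    edgeCount-≤ : edgeCount G ≤ 2 * (n * (3 + scales * (scales * 2)))
    edgeCount-≤ = begin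
      edgeCount G
        ≡⟨ trans (sum-allFin λ i → List.sum (map (upper-edge i) (allFin n))) (sum-cong-≗ {n} λ i → sum-allFin (upper-edge i)) ⟩
      (sum λ i → sum (upper-edge i))
        -- Dropping the condition `toℕ i <ᵇ toℕ j` costs only a constant factor.
        ≤⟨ sum-mono-≤ {n} (λ i → sum-mono-≤ {n} λ j → if-∧-≤ (adj G i j) (toℕ i <ᵇ toℕ j) edge-charged) ⟩
      (sum λ i → sum λ j → charge i j + charge j i)
        ≡⟨ trans (sum-cong-≗ λ i → ∑-distrib-+ (charge i) (λ j → charge j i)) (∑-distrib-+ (λ i → sum (charge i)) _) ⟩
      total + (sum λ i → sum λ j → charge j i)
        ≡⟨ cong (total +_) (∑-comm λ i j → charge j i) ⟩
      total + total
        ≡⟨ cong (total +_) (+-identityʳ total) ⟨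
      2 * total
        ≤⟨ *-monoʳ-≤ 2 (sum-≤-* {n} row-charge) ⟩
      2 * (n * (3 + scales * (scales * 2))) ∎
      where
      open ≤-Reasoning
      upper-edge : Fin n → Fin n → ℕ
      upper-edge i j = if adj G i j ∧ (toℕ i <ᵇ toℕ j) then 1 else 0

      total : ℕ
      total = sum λ i → sum (charge i)

-- The numerical bound.

polylog-bound : ∀ n L → 1 ≤ L → 2 * (n * (3 + 2 * suc L * (2 * suc L * 2))) ≤ 70 * n * L ^ 2
polylog-bound n L 1≤L = begin
  2 * (n * (3 + 2 * suc L * (2 * suc L * 2)))
    -- Since `1 ≤ L`, the term 3 is at most 3L² and 2(L + 1) at most 4L; then 2(3 + 32) = 70.
    ≤⟨ *-monoʳ-≤ 2 (*-monoʳ-≤ n (+-mono-≤ (*-monoʳ-≤ 3 (*-mono-≤ 1≤L 1≤L)) (*-mono-≤ scales≤ (*-monoˡ-≤ 2 scales≤)))) ⟩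
  2 * (n * (3 * (L * L) + 4 * L * (4 * L * 2)))
    ≡⟨ solve 2 (λ n L → con 2 :* (n :* (con 3 :* (L :* L) :+ con 4 :* L :* (con 4 :* L :* con 2))) := con 70 :* n :* (L :* (L :* con 1))) refl n L ⟩
  70 * n * L ^ 2 ∎
  where
  open ≤-Reasoning
  open +-*-Solver
  scales≤ : 2 * suc L ≤ 4 * L
  scales≤ = ≤-trans (*-monoʳ-≤ 2 (+-monoˡ-≤ L 1≤L)) (≤-reflexive (solve 1 (λ L → con 2 :* (L :+ L) := con 4 :* L) refl L))

theorem4p16 : ∃[ C ] ∃[ N₀ ] ∀ (n : ℕ) → N₀ ≤ n → (G : EOGraph n) →
    ¬ ContainsP5-1342 G → edgeCount G ≤ C * n * (⌊log₂ n ⌋ ^ 2)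
-- From `n` = 2 on, the logarithm is at least 1, as the numerical bound requires.
theorem4p16 = 70 , 2 , λ n 2≤n G P-free →
  ≤-trans (Proof.edgeCount-≤ G P-free) (polylog-bound n ⌊log₂ n ⌋ (⌊log₂⌋-mono-≤ 2≤n))
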